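{- Let $\mathrm{dist}$ be a distance measure and let $\Pi$ be an SSP-NP-complete problem such that \textsc{3Sat} is blow-up SSP reducible to $\Pi$ with respect to $\mathrm{dist}$. Then every SSP problem $\Pi'$ to which there is a blow-up preserving SSP reduction from $\Pi$ is such that \textsc{3Sat} is blow-up SSP reducible to $\Pi'$ with respect to $\mathrm{dist}$.
   Context: An SSP problem is $\Pi = (\mathcal{I}, \mathcal{U}, \mathcal{S})$ with instances $\mathcal{I} \subseteq \{0,1\}^*$, and for each $I$ a universe $\mathcal{U}(I)$ and solution set $\mathcal{S}(I) \subseteq 2^{\mathcal{U}(I)}$; $I$ is a yes-instance iff $\mathcal{S}(I)\ne\emptyset$. \textsc{Satisfiability} as SSP problem: instance = literal set $L = \{\ell_1,\dots,\ell_n,\overline{\ell}_1,\dots,\overline{\ell}_n\}$ and clauses $C_j \subseteq L$; universe $L$; solutions are the $L' \subseteq L$ with $|L'\cap\{\ell_i,\overline{\ell}_i\}|=1$ for all $i$ and $|L'\cap C_j| \ge 1$ for all $j$. \textsc{3Sat}: the same with every clause having three literals. An SSP reduction from $(\mathcal{I},\mathcal{U},\mathcal{S})$ to $(\mathcal{I}',\mathcal{U}',\mathcal{S}')$: polynomial-time $g$ with $\mathcal{S}(I)\ne\emptyset \iff \mathcal{S}'(g(I))\ne\emptyset$ and polynomial-time injective $f_I : \mathcal{U}(I)\to\mathcal{U}'(g(I))$ with $\{f_I(S): S\in\mathcal{S}(I)\} = \{S'\cap f_I(\mathcal{U}(I)) : S'\in\mathcal{S}'(g(I))\}$. A problem is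 SSP-NP-complete if its solutions are verifiable in polynomial time and there is an SSP reduction from \textsc{Satisfiability} to it. A blow-up preserving SSP reduction from $\Pi$ to $\Pi'$ is an SSP reduction $(g, f_I)$ such that for every instance $I$ and every $u' \in \mathcal{U}'(g(I))$, either $u' \in f_I(\mathcal{U}(I))$, or $u'$ lies in no solution $S' \in \mathcal{S}'(g(I))$, or $u'$ lies in every solution $S' \in \mathcal{S}'(g(I))$. A distance measure assigns to each set $U$ a polynomial-time computable $\mathrm{dist}_U : 2^U\times 2^U\to\mathbb{R}_{\ge0}$, invariant under injective maps ($\mathrm{dist}_U(A_1,A_2)=\mathrm{dist}_{U'}(f(A_1),f(A_2))$), invariant under union ($\mathrm{dist}_U(A_1,A_2)=\mathrm{dist}_U(A_1\cup\{x\},A_2\cup\{x\})$ for $x\notin A_1\cup A_2$), with $\mathrm{dist}_U(A,A)=0$. \textsc{3Sat} is blow-up SSP reducible to $\Pi'=(\mathcal{I}',\mathcal{U}',\mathcal{S}')$ with respect to $\mathrm{dist}$ if for every \textsc{3Sat} instance $I$ with literals $L$ and every $L_b\subseteq L$ with $\ell_i\in L_b\iff\overline{\ell}_i\in L_b$ there is an SSP reduction $(g,f_I)$ and a polynomial-time computable $\beta_I\in\mathbb{N}$ such that for all $S_1,S_2\in\mathcal{S}'(g(I))$: $f_I(L_b)\cap S_1 = f_I(L_b)\cap S_2 \iff \mathrm{dist}(S_1,S_2)\le\beta_I$. -}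

module Defs where

open import Data.Bool.Base using (Bool; true; false)
open import Data.Fin.Base using (Fin; toℕ; _↑ˡ_; _↑ʳ_)
import Data.Fin.Properties as Fin
open import Data.Fin.Subset
  using (Subset; _∈_; _∉_; _∩_; _∪_; ⁅_⁆; ∣_∣) renaming (⊤ to full)
open import Data.Fin.Subset.Properties using (_∈?_)
open import Data.Integer.Base as ℤ using (ℤ; +_)
open import Data.List.Base as List using (List; []; _∷_; _++_; replicate; allFin; filter)
open import Data.List.Membership.Propositional using () renaming (_∈_ to _∈ₗ_)
import Data.List.Properties as List
open import Data.List.Relation.Unary.All as All using (All)
open import Data.Nat.Base as ℕ using (ℕ; zero; suc; _+_; _*_; _^_; _≤_; _≥_)
open import Data.Nat.Binary.Base using (ℕᵇ; zero; 2[1+_]; 1+[2_]; fromℕ)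
import Data.Nat.Properties as ℕ
open import Data.Product using (Σ; ∃; _×_; _,_; proj₁; proj₂; Σ-syntax; ∃-syntax)
open import Data.Rational.Base as ℚ using (ℚ; 0ℚ; 1ℚ)
import Data.Rational.Properties as ℚ
open import Data.Sum.Base using (_⊎_; inj₁; inj₂)
open import Data.Vec.Base using ([]; _∷_; toList; tabulate)
open import Function.Base using (_∘_)
open import Function.Bundles using (_⇔_; mk⇔)
open import Function.Definitions using (Injective)
open import Level using (0ℓ)
open import Relation.Binary.Definitions using (tri<; tri≈; tri>)
open import Relation.Binary.PropositionalEquality
open import Relation.Nullary using (does; ¬_)
open import Relation.Nullary.Decidable using (_×-dec_)
open import Relation.Unary using (Pred; Decidable; Satisfiable; _≐_)

------------------------------------------------------------------------
-- Polynomial time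
--
-- The machine model is a variable-free presentation of the WHILE
-- language on binary trees (N. D. Jones, "Computability and
-- Complexity").  Every primitive step is charged the size of the data
-- it reads or produces, so the cost of a run bounds the size of its
-- result, and the programs of polynomial cost are exactly the
-- polynomial-time ones in the Turing machine sense.

data 𝔻 : Set where
  leaf : 𝔻
  node : 𝔻 → 𝔻 → 𝔻

size : 𝔻 → ℕ
size leaf       = 1
size (node x y) = 1 + size x + size y

left right : 𝔻 → 𝔻
left leaf        = leaf
left (node x _)  = x
right leaf       = leaf
right (node _ y) = y

infixl 5 _⨾_

data Prog : Set where
  idᵖ leafᵖ leftᵖ rightᵖ : Prog
  _⨾_                    : Prog → Prog → Prog
  ⟨_,_⟩                  : Prog → Prog → Prog
  ifᵖ                    : (test then-part else-part : Prog) → Prog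
  whileᵖ                 : (test body : Prog) → Prog

-- Run p x y t: started on x, the program p halts with result y at cost t.
-- A test fails iff its result is leaf.
data Run : Prog → 𝔻 → 𝔻 → ℕ → Set where
  run-id    : ∀ {x} → Run idᵖ x x (size x)
  run-leaf  : ∀ {x} → Run leafᵖ x leaf 1
  run-left  : ∀ {x} → Run leftᵖ x (left x) (size x)
  run-right : ∀ {x} → Run rightᵖ x (right x) (size x)
  run-seq   : ∀ {p q x y z s t} →
              Run p x y s → Run q y z t → Run (p ⨾ q) x z (s + t)
  run-pair  : ∀ {p q x y z s t} →
              Run p x y s → Run q x z t → Run ⟨ p , q ⟩ x (node y z) (1 + s + t)
  run-then  : ∀ {b p q x l r y s t} →
              Run b x (node l r) s → Run p x y t →
              Run (ifᵖ b p q) x y (s + t)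
  run-else  : ∀ {b p q x y s t} →
              Run b x leaf s → Run q x y t →
              Run (ifᵖ b p q) x y (s + t)
  run-stop  : ∀ {b p x s} →
              Run b x leaf s → Run (whileᵖ b p) x x (s + size x)
  run-loop  : ∀ {b p x l r y z s t u} →
              Run b x (node l r) s → Run p x y t → Run (whileᵖ b p) y z u →
              Run (whileᵖ b p) x z (s + t + u)

-- One program turns the code  input a  into the code  output a  for every
-- a : A, in time polynomial in  measure a.
PolyTimeIn : {A : Set} (measure : A → ℕ) (input output : A → 𝔻) → Set
PolyTimeIn measure input output =
  Σ[ p ∈ Prog ] ∃[ c ] ∃[ k ] ∀ a →
    Σ[ t ∈ ℕ ] Run p (input a) (output a) t × t ≤ c * suc (measure a) ^ k

PolyTime : {A : Set} (input output : A → 𝔻) → Set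
PolyTime input = PolyTimeIn (size ∘ input) input

codeBool : Bool → 𝔻
codeBool false = leaf
codeBool true  = node leaf leaf

codeList : {A : Set} → (A → 𝔻) → List A → 𝔻
codeList code []       = leaf
codeList code (x ∷ xs) = node (code x) (codeList code xs)

codeBits : List Bool → 𝔻
codeBits = codeList codeBool

codeUnary : ℕ → 𝔻
codeUnary k = codeBits (replicate k true)

codeℕᵇ : ℕᵇ → 𝔻
codeℕᵇ zero     = leaf
codeℕᵇ 2[1+ n ] = node leaf (codeℕᵇ n)
codeℕᵇ 1+[2 n ] = node (node leaf leaf) (codeℕᵇ n)

codeBinary : ℕ → 𝔻
codeBinary n = codeℕᵇ (fromℕ n)

------------------------------------------------------------------------
-- Finite universes: finite sets of bit strings, in some enumeration

record Universe : Set where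
  field
    card           : ℕ
    name           : Fin card → List Bool
    name-injective : Injective _≡_ _≡_ name

  codeElem : Fin card → 𝔻
  codeElem u = codeBits (name u)

  codeSubset : Subset card → 𝔻
  codeSubset S = codeList codeElem (filter (_∈? S) (allFin card))

open Universe public

codeUniverse : Universe → 𝔻
codeUniverse U = codeSubset U full

image : ∀ {m n} → (Fin m → Fin n) → Subset m → Subset n
image f S = tabulate λ y → does (Fin.any? λ x → (x ∈? S) ×-dec (f x Fin.≟ y))

------------------------------------------------------------------------
-- SSP problems

record SSP : Set₁ where
  field
    -- The set of instances is the image of encode in {0,1}*.
    Instance         : Set
    encode           : Instance → List Bool
    encode-injective : Injective _≡_ _≡_ encode
    𝒰                : Instance → Universe
    𝒮                : (I : Instance) → Pred (Subset (card (𝒰 I))) 0ℓ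

  codeInstance : Instance → 𝔻
  codeInstance I = codeBits (encode I)

open SSP public

record SSPReduction (Π Π′ : SSP) : Set where
  field
    g           : Instance Π → Instance Π′
    g-poly      : PolyTime (codeInstance Π) (codeInstance Π′ ∘ g)
    g-correct   : ∀ I → Satisfiable (𝒮 Π I) ⇔ Satisfiable (𝒮 Π′ (g I))
    f           : ∀ I → Fin (card (𝒰 Π I)) → Fin (card (𝒰 Π′ (g I)))
    f-poly      : PolyTime {A = Σ[ I ∈ Instance Π ] Fin (card (𝒰 Π I))}
                    (λ (I , u) → node (codeInstance Π I) (codeElem (𝒰 Π I) u))
                    (λ (I , u) → codeElem (𝒰 Π′ (g I)) (f I u))
    f-injective : ∀ I → Injective _≡_ _≡_ (f I)
    f-solutions : ∀ I →
      (λ T → ∃[ S ] 𝒮 Π I S × T ≡ image (f I) S) ≐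
      (λ T → ∃[ S′ ] 𝒮 Π′ (g I) S′ × T ≡ S′ ∩ image (f I) full)

-- As usual for NP, verification time is measured in the instance alone.
PolyTimeVerifiable : SSP → Set
PolyTimeVerifiable Π =
  Σ[ solution? ∈ (∀ I → Decidable (𝒮 Π I)) ]
    PolyTimeIn {A = Σ[ I ∈ Instance Π ] Subset (card (𝒰 Π I))}
      (λ (I , S) → size (codeInstance Π I))
      (λ (I , S) → node (codeInstance Π I) (codeSubset (𝒰 Π I) S))
      (λ (I , S) → codeBool (does (solution? I S)))

record BlowUpPreservingReduction (Π Π′ : SSP) : Set where
  field
    reduction : SSPReduction Π Π′
  open SSPReduction reduction public
  field
    preserving : ∀ I (u′ : Fin (card (𝒰 Π′ (g I)))) →
      u′ ∈ image (f I) full ⊎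
      (∀ S′ → 𝒮 Π′ (g I) S′ → u′ ∉ S′) ⊎
      (∀ S′ → 𝒮 Π′ (g I) S′ → u′ ∈ S′)

------------------------------------------------------------------------
-- Satisfiability and 3Sat

record CNF : Set where
  constructor cnf
  field
    vars    : ℕ
    clauses : List (Subset (vars + vars))

open CNF public

Literal : ℕ → Set
Literal n = Fin (n + n)

pos neg : ∀ n → Fin n → Literal n
pos n i = i ↑ˡ n
neg n i = n ↑ʳ i

replicate-injective : ∀ {m n} → replicate m true ≡ replicate n true → m ≡ n
replicate-injective {m} {n} eq =
  trans (sym (List.length-replicate m))
        (trans (cong List.length eq) (List.length-replicate n))

literals : ℕ → Universe
literals n .card             = n + n
literals n .name x           = replicate (toℕ x) true
literals n .name-injective e = Fin.toℕ-injective (replicate-injective e)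

SatSolution : (φ : CNF) → Subset (vars φ + vars φ) → Set
SatSolution φ L′ =
  (∀ i → ∣ L′ ∩ (⁅ pos (vars φ) i ⁆ ∪ ⁅ neg (vars φ) i ⁆) ∣ ≡ 1) ×
  (∀ C → C ∈ₗ clauses φ → ∣ L′ ∩ C ∣ ≥ 1)

-- n is written in unary (so that the encoding is as long as the literal
-- set), each clause as a 1 followed by its 2n characteristic bits.
encodeClauses : ∀ {m} → List (Subset m) → List Bool
encodeClauses []       = false ∷ []
encodeClauses (C ∷ Cs) = true ∷ toList C ++ encodeClauses Cs

encodeCNF : CNF → List Bool
encodeCNF (cnf n Cs) = replicate n true ++ false ∷ encodeClauses Cs

toList-++-injective : ∀ {m} (C D : Subset m) {xs ys} →
  toList C ++ xs ≡ toList D ++ ys → C ≡ D × xs ≡ ys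
toList-++-injective []      []      eq = refl , eq
toList-++-injective (x ∷ C) (y ∷ D) eq with List.∷-injective eq
... | refl , eq′ with toList-++-injective C D eq′
... | refl , eq″ = refl , eq″

encodeClauses-injective : ∀ {m} (Cs Ds : List (Subset m)) →
  encodeClauses Cs ≡ encodeClauses Ds → Cs ≡ Ds
encodeClauses-injective []       []       eq = refl
encodeClauses-injective (C ∷ Cs) (D ∷ Ds) eq
  with toList-++-injective C D (List.∷-injectiveʳ eq)
... | refl , eq′ = cong (C ∷_) (encodeClauses-injective Cs Ds eq′)

unary-++-injective : ∀ m n {xs ys} →
  replicate m true ++ false ∷ xs ≡ replicate n true ++ false ∷ ys →
  m ≡ n × xs ≡ ys
unary-++-injective zero    zero    eq = refl , List.∷-injectiveʳ eq
unary-++-injective (suc m) (suc n) eq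
  with unary-++-injective m n (List.∷-injectiveʳ eq)
... | refl , eq′ = refl , eq′

encodeCNF-injective : Injective _≡_ _≡_ encodeCNF
encodeCNF-injective {cnf m Cs} {cnf n Ds} eq with unary-++-injective m n eq
... | refl , eq′ = cong (cnf m) (encodeClauses-injective Cs Ds eq′)

Sat : SSP
Sat .Instance         = CNF
Sat .encode           = encodeCNF
Sat .encode-injective = encodeCNF-injective
Sat .𝒰 φ              = literals (vars φ)
Sat .𝒮                = SatSolution

ThreeLiterals : CNF → Set
ThreeLiterals φ = All (λ C → ∣ C ∣ ≡ 3) (clauses φ)

3Sat : SSP
3Sat .Instance                  = Σ CNF ThreeLiterals
3Sat .encode (φ , _)            = encodeCNF φ
3Sat .encode-injective {_ , p} {_ , q} eq with encodeCNF-injective eq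
... | refl = cong (_ ,_) (All.irrelevant ℕ.≡-irrelevant p q)
3Sat .𝒰 (φ , _)                 = literals (vars φ)
3Sat .𝒮 (φ , _)                 = SatSolution φ

SSP-NP-complete : SSP → Set
SSP-NP-complete Π = PolyTimeVerifiable Π × SSPReduction Sat Π

------------------------------------------------------------------------
-- Real numbers: Dedekind cuts
--
-- Requiring cuts to be located excludes no distance measure: an
-- approximation algorithm for a real number locates its cut.

record ℝ : Set₁ where
  field
    lower upper     : Pred ℚ 0ℓ
    lower-inhabited : Satisfiable lower
    upper-inhabited : Satisfiable upper
    lower-rounded   : ∀ q → lower q ⇔ (∃[ r ] q ℚ.< r × lower r)
    upper-rounded   : ∀ q → upper q ⇔ (∃[ r ] r ℚ.< q × upper r)
    disjoint        : ∀ q → ¬ (lower q × upper q)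
    located         : ∀ {q r} → q ℚ.< r → lower q ⊎ upper r

open ℝ public

infix 4 _≤ᵣ_ _≃ᵣ_

_≤ᵣ_ _≃ᵣ_ : ℝ → ℝ → Set
x ≤ᵣ y = ∀ q → lower x q → lower y q
x ≃ᵣ y = x ≤ᵣ y × y ≤ᵣ x

fromℚ : ℚ → ℝ
fromℚ p .lower q         = q ℚ.< p
fromℚ p .upper q         = p ℚ.< q
fromℚ p .lower-inhabited =
  p ℚ.- 1ℚ , subst (p ℚ.- 1ℚ ℚ.<_) (ℚ.+-identityʳ p)
                   (ℚ.+-monoʳ-< p (ℚ.negative⁻¹ (ℚ.- 1ℚ)))
fromℚ p .upper-inhabited =
  p ℚ.+ 1ℚ , subst (ℚ._< p ℚ.+ 1ℚ) (ℚ.+-identityʳ p)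
                   (ℚ.+-monoʳ-< p (ℚ.positive⁻¹ 1ℚ))
fromℚ p .lower-rounded q = mk⇔ (λ q<p → ℚ.<-dense q<p) (λ (_ , q<r , r<p) → ℚ.<-trans q<r r<p)
fromℚ p .upper-rounded q =
  mk⇔ (λ p<q → let r , p<r , r<q = ℚ.<-dense p<q in r , r<q , p<r)
      (λ (_ , r<q , p<r) → ℚ.<-trans p<r r<q)
fromℚ p .disjoint q (q<p , p<q) = ℚ.<-asym q<p p<q
fromℚ p .located {q} {r} q<r with ℚ.<-cmp q p
... | tri< q<p _ _ = inj₁ q<p
... | tri≈ _ q≡p _ = inj₂ (subst (ℚ._< r) q≡p q<r)
... | tri> _ _ p<q = inj₂ (ℚ.<-trans p<q q<r)

fromℕᵣ : ℕ → ℝ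
fromℕᵣ n = fromℚ (+ n ℚ./ 1)

dyadic : ℤ → ℕ → ℚ
dyadic m k = (m ℚ./ (2 ^ k)) {{ℕ.m^n≢0 2 k}}

------------------------------------------------------------------------
-- Distance measures

record DistanceMeasure : Set₁ where
  field
    dist        : (U : Universe) → Subset (card U) → Subset (card U) → ℝ
    dist-nonneg : ∀ U A₁ A₂ → fromℚ 0ℚ ≤ᵣ dist U A₁ A₂

    -- Polynomial-time computability of a real-valued function: given
    -- the precision k in unary, compute some m with
    -- |dist U A₁ A₂ - m / 2ᵏ| ≤ 1 / 2ᵏ.
    approx      : (U : Universe) → Subset (card U) → Subset (card U) → ℕ → ℕ
    approx-poly :
      PolyTime {A = Σ[ U ∈ Universe ] Subset (card U) × Subset (card U) × ℕ}
        (λ (U , A₁ , A₂ , k) →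
          node (codeUniverse U)
               (node (codeSubset U A₁) (node (codeSubset U A₂) (codeUnary k))))
        (λ (U , A₁ , A₂ , k) → codeBinary (approx U A₁ A₂ k))
    approx-≤    : ∀ U A₁ A₂ k →
      fromℚ (dyadic (+ approx U A₁ A₂ k ℤ.- + 1) k) ≤ᵣ dist U A₁ A₂
    approx-≥    : ∀ U A₁ A₂ k →
      dist U A₁ A₂ ≤ᵣ fromℚ (dyadic (+ approx U A₁ A₂ k ℤ.+ + 1) k)

    dist-injective : ∀ U U′ (f : Fin (card U) → Fin (card U′)) →
      Injective _≡_ _≡_ f → ∀ A₁ A₂ →
      dist U A₁ A₂ ≃ᵣ dist U′ (image f A₁) (image f A₂)
    dist-union     : ∀ U A₁ A₂ x → x ∉ A₁ ∪ A₂ →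
      dist U A₁ A₂ ≃ᵣ dist U (A₁ ∪ ⁅ x ⁆) (A₂ ∪ ⁅ x ⁆)
    dist-self      : ∀ U A → dist U A A ≃ᵣ fromℚ 0ℚ

open DistanceMeasure public

------------------------------------------------------------------------
-- Blow-up reducibility of 3Sat

-- The reduction and β are chosen after I and L_b (here L-b); both are
-- nevertheless defined, and polynomial-time, on all instances.
BlowUpReducible : DistanceMeasure → SSP → Set
BlowUpReducible d Π′ =
  (I : Instance 3Sat) (L-b : Subset (card (𝒰 3Sat I))) →
  (let n = vars (proj₁ I) in ∀ i → pos n i ∈ L-b ⇔ neg n i ∈ L-b) →
  Σ[ red ∈ SSPReduction 3Sat Π′ ]
  Σ[ β ∈ (Instance 3Sat → ℕ) ]
    let open SSPReduction red in
    PolyTime (codeInstance 3Sat) (codeBinary ∘ β) ×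
    (∀ S₁ S₂ → 𝒮 Π′ (g I) S₁ → 𝒮 Π′ (g I) S₂ →
      (image (f I) L-b ∩ S₁ ≡ image (f I) L-b ∩ S₂) ⇔
      (dist d (𝒰 Π′ (g I)) S₁ S₂ ≤ᵣ fromℕᵣ (β I)))

-- The composite 3Sat → Π → Π′ keeps the bound β.  A solution S′ of g I is the
-- image of a solution of I together with S′ ∖ f(𝒰(I)).  By the blow-up
-- preserving property that remainder is the same set for all solutions, so
-- distances between solutions survive: invariance under injections moves them
-- into the image, and invariance under union adjoins the remainder.
module Submission where

open import Data.Empty using (⊥-elim)
open import Data.Fin.Base using (Fin; zero; suc)
import Data.Fin.Properties as Fin
open import Data.Fin.Subset
  using (Subset; _∈_; _∉_; _⊆_; _⊂_; _∩_; _∪_; _-_; ⁅_⁆; ∁)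
  renaming (⊤ to full)
open import Data.Fin.Subset.Induction using (Acc; acc; ⊂-wellFounded)
open import Data.Fin.Subset.Properties
open import Data.Nat.Base using (ℕ; zero; suc; NonZero; _+_; _*_; _^_; _≤_; s≤s)
import Data.Nat.Properties as ℕ
open import Algebra.Properties.CommutativeSemigroup ℕ.*-commutativeSemigroup
  using (interchange)
open import Data.Product using (_×_; _,_; proj₁; proj₂; ∃-syntax)
open import Data.Sum.Base using (inj₁; inj₂; [_,_]′)
open import Data.Vec.Base using (_∷_; there)
open import Data.Vec.Properties using (lookup∘tabulate; lookup⇒[]=; []=⇒lookup)
open import Function.Base using (_∘_)
open import Function.Bundles using (_⇔_; mk⇔)
open import Function.Definitions using (Injective)
import Function.Properties.Equivalence as ⇔
open import Relation.Binary.PropositionalEquality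
  using (_≡_; refl; sym; trans; cong; subst; subst₂; module ≡-Reasoning)
open import Relation.Nullary using (Dec; does; yes; no)
open import Relation.Nullary.Decidable using (_×-dec_; dec-true)

open import Defs

-- Polynomial time

suc-*-^-≤ : ∀ c n k .{{_ : NonZero n}} → suc (c * n ^ k) ≤ suc c * n ^ k
suc-*-^-≤ c n k = ℕ.+-monoˡ-≤ (c * n ^ k) (ℕ.m^n>0 n k)

-- For nonzero `n`, powers grow with the exponent, so `k₁ + k₂` dominates both exponents at once.
polynomial-+ : ∀ c₁ c₂ n k₁ k₂ .{{_ : NonZero n}} →
  c₁ * n ^ k₁ + c₂ * n ^ k₂ ≤ (c₁ + c₂) * n ^ (k₁ + k₂)
polynomial-+ c₁ c₂ n k₁ k₂ = begin
  c₁ * n ^ k₁ + c₂ * n ^ k₂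
    ≤⟨ ℕ.+-mono-≤ (ℕ.*-monoʳ-≤ c₁ (ℕ.^-monoʳ-≤ n (ℕ.m≤m+n k₁ k₂)))
                  (ℕ.*-monoʳ-≤ c₂ (ℕ.^-monoʳ-≤ n (ℕ.m≤n+m k₂ k₁))) ⟩
  c₁ * n ^ (k₁ + k₂) + c₂ * n ^ (k₁ + k₂)
    ≡⟨ ℕ.*-distribʳ-+ (n ^ (k₁ + k₂)) c₁ c₂ ⟨
  (c₁ + c₂) * n ^ (k₁ + k₂) ∎
  where open ℕ.≤-Reasoning

^-distribʳ-* : ∀ k m n → (m * n) ^ k ≡ m ^ k * n ^ k
^-distribʳ-* zero    m n = refl
^-distribʳ-* (suc k) m n = trans (cong (m * n *_) (^-distribʳ-* k m n))
  (interchange m n (m ^ k) (n ^ k))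

-- The inner `suc` is the one in the definition of `PolyTimeIn`; as `n ^ k₁` is at least 1, it is
-- absorbed into the coefficient `suc c₁`.
polynomial-∘ : ∀ c₁ c₂ n k₁ k₂ .{{_ : NonZero n}} →
  c₂ * suc (c₁ * n ^ k₁) ^ k₂ ≤ (c₂ * suc c₁ ^ k₂) * n ^ (k₁ * k₂)
polynomial-∘ c₁ c₂ n k₁ k₂ = begin
  c₂ * suc (c₁ * n ^ k₁) ^ k₂
    ≤⟨ ℕ.*-monoʳ-≤ c₂ (ℕ.^-monoˡ-≤ k₂ (suc-*-^-≤ c₁ n k₁)) ⟩
  c₂ * (suc c₁ * n ^ k₁) ^ k₂
    ≡⟨ cong (c₂ *_) (^-distribʳ-* k₂ (suc c₁) (n ^ k₁)) ⟩
  c₂ * (suc c₁ ^ k₂ * (n ^ k₁) ^ k₂)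
    ≡⟨ cong (λ x → c₂ * (suc c₁ ^ k₂ * x)) (ℕ.^-*-assoc n k₁ k₂) ⟩
  c₂ * (suc c₁ ^ k₂ * n ^ (k₁ * k₂))
    ≡⟨ ℕ.*-assoc c₂ (suc c₁ ^ k₂) _ ⟨
  (c₂ * suc c₁ ^ k₂) * n ^ (k₁ * k₂) ∎
  where open ℕ.≤-Reasoning

size-left : ∀ x → size (left x) ≤ size x
size-left leaf       = ℕ.≤-refl
size-left (node x y) = ℕ.m≤n⇒m≤1+n (ℕ.m≤m+n (size x) (size y))

size-right : ∀ x → size (right x) ≤ size x
size-right leaf       = ℕ.≤-refl
size-right (node x y) = ℕ.m≤n⇒m≤1+n (ℕ.m≤n+m (size y) (size x))

-- Each primitive is charged at least the size of what it produces. Hence a polynomial-time program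
-- has output of polynomial size, which composition needs.
size≤cost : ∀ {p x y t} → Run p x y t → size y ≤ t
size≤cost run-id         = ℕ.≤-refl
size≤cost run-leaf       = ℕ.≤-refl
size≤cost (run-left {x})  = size-left x
size≤cost (run-right {x}) = size-right x
size≤cost (run-seq {s = s} r r′)  = ℕ.m≤n⇒m≤o+n s (size≤cost r′)
size≤cost (run-pair r r′) = s≤s (ℕ.+-mono-≤ (size≤cost r) (size≤cost r′))
size≤cost (run-then {s = s} _ r)  = ℕ.m≤n⇒m≤o+n s (size≤cost r)
size≤cost (run-else {s = s} _ r)  = ℕ.m≤n⇒m≤o+n s (size≤cost r)
size≤cost (run-stop {s = s} _)    = ℕ.m≤n+m _ s
size≤cost (run-loop {s = s} {t = t} _ _ r) = ℕ.m≤n⇒m≤o+n (s + t) (size≤cost r)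

module _ {A : Set} {input : A → 𝔻} where

  polyTime-∘ : {B : Set} {mid output : B → 𝔻} (h : A → B) →
    PolyTime input (mid ∘ h) → PolyTime mid output →
    PolyTime input (output ∘ h)
  polyTime-∘ {mid = mid} h (p , c₁ , k₁ , run₁) (q , c₂ , k₂ , run₂) =
    p ⨾ q , c₁ + c₂ * suc c₁ ^ k₂ , k₁ + k₁ * k₂ , λ a →
      let (s , r₁ , s≤) = run₁ a
          (t , r₂ , t≤) = run₂ (h a)
          n = suc (size (input a))
          open ℕ.≤-Reasoning
      in s + t , run-seq r₁ r₂ , (begin
        s + t
          ≤⟨ ℕ.+-mono-≤ s≤ t≤ ⟩
        c₁ * n ^ k₁ + c₂ * suc (size (mid (h a))) ^ k₂
          -- The second run is timed in the size of the intermediate code, which is at most the cost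
          -- of the first run.
          ≤⟨ ℕ.+-monoʳ-≤ (c₁ * n ^ k₁) (ℕ.*-monoʳ-≤ c₂ (ℕ.^-monoˡ-≤ k₂
               (s≤s (ℕ.≤-trans (size≤cost r₁) s≤)))) ⟩
        c₁ * n ^ k₁ + c₂ * suc (c₁ * n ^ k₁) ^ k₂
          ≤⟨ ℕ.+-monoʳ-≤ (c₁ * n ^ k₁) (polynomial-∘ c₁ c₂ n k₁ k₂) ⟩
        c₁ * n ^ k₁ + (c₂ * suc c₁ ^ k₂) * n ^ (k₁ * k₂)
          ≤⟨ polynomial-+ c₁ (c₂ * suc c₁ ^ k₂) n k₁ (k₁ * k₂) ⟩
        (c₁ + c₂ * suc c₁ ^ k₂) * n ^ (k₁ + k₁ * k₂) ∎)

  polyTime-pair : {output₁ output₂ : A → 𝔻} →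
    PolyTime input output₁ → PolyTime input output₂ →
    PolyTime input (λ a → node (output₁ a) (output₂ a))
  polyTime-pair (p , c₁ , k₁ , run₁) (q , c₂ , k₂ , run₂) =
    ⟨ p , q ⟩ , suc c₁ + c₂ , k₁ + k₂ , λ a →
      let (s , r₁ , s≤) = run₁ a
          (t , r₂ , t≤) = run₂ a
          n = suc (size (input a))
          open ℕ.≤-Reasoning
      in suc s + t , run-pair r₁ r₂ , (begin
        suc s + t
          ≤⟨ ℕ.+-mono-≤ (s≤s s≤) t≤ ⟩
        suc (c₁ * n ^ k₁) + c₂ * n ^ k₂
          -- The unit charged for building the pair goes into the first coefficient.
          ≤⟨ ℕ.+-monoˡ-≤ (c₂ * n ^ k₂) (suc-*-^-≤ c₁ n k₁) ⟩
        suc c₁ * n ^ k₁ + c₂ * n ^ k₂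
          ≤⟨ polynomial-+ (suc c₁) c₂ n k₁ k₂ ⟩
        (suc c₁ + c₂) * n ^ (k₁ + k₂) ∎)

polyTime-left : {A : Set} {x y : A → 𝔻} → PolyTime (λ a → node (x a) (y a)) x
polyTime-left {x = x} {y} = leftᵖ , 1 , 1 , λ a →
  let m = size (node (x a) (y a))
      open ℕ.≤-Reasoning
  in m , run-left , (begin
    m               ≤⟨ ℕ.n≤1+n m ⟩
    suc m           ≡⟨ ℕ.^-identityʳ (suc m) ⟨
    suc m ^ 1       ≡⟨ ℕ.*-identityˡ (suc m ^ 1) ⟨
    1 * suc m ^ 1   ∎)

-- Images of finite subsets

module _ {m n} (f : Fin m → Fin n) (S : Subset m) where

  private
    preimage? : ∀ y → Dec (∃[ x ] x ∈ S × f x ≡ y)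
    preimage? y = Fin.any? λ x → (x ∈? S) ×-dec (f x Fin.≟ y)

  ∈-image⁺ : ∀ {y} → ∃[ x ] x ∈ S × f x ≡ y → y ∈ image f S
  ∈-image⁺ {y} p = lookup⇒[]= y (image f S)
    (trans (lookup∘tabulate (does ∘ preimage?) y) (dec-true (preimage? y) p))

  ∈-image⁻ : ∀ {y} → y ∈ image f S → ∃[ x ] x ∈ S × f x ≡ y
  ∈-image⁻ {y} y∈ with preimage? y
    | trans (sym (lookup∘tabulate (does ∘ preimage?) y)) ([]=⇒lookup y∈)
  ... | yes p | _ = p

∈-image : ∀ {m n} (f : Fin m → Fin n) {S x} → x ∈ S → f x ∈ image f S
∈-image f {S} x∈S = ∈-image⁺ f S (_ , x∈S , refl)

image-∘ : ∀ {l m n} (f : Fin l → Fin m) (h : Fin m → Fin n) S →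
  image (h ∘ f) S ≡ image h (image f S)
image-∘ f h S = ⊆-antisym to from
  where
  to : image (h ∘ f) S ⊆ image h (image f S)
  to y∈ with ∈-image⁻ (h ∘ f) S y∈
  ... | x , x∈S , refl = ∈-image h (∈-image f x∈S)

  from : image h (image f S) ⊆ image (h ∘ f) S
  from z∈ with ∈-image⁻ h (image f S) z∈
  ... | y , y∈ , refl with ∈-image⁻ f S y∈
  ... | x , x∈S , refl = ∈-image (h ∘ f) x∈S

module _ {m n} {f : Fin m → Fin n} (f-inj : Injective _≡_ _≡_ f) where

  ∈-image-injective : ∀ S {x} → f x ∈ image f S → x ∈ S
  ∈-image-injective S fx∈ =
    let x′ , x′∈S , eq = ∈-image⁻ f S fx∈ in subst (_∈ S) (f-inj eq) x′∈S

  image-injective : Injective _≡_ _≡_ (image f)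
  image-injective {S} {T} eq = ⊆-antisym
    (λ x∈ → ∈-image-injective T (subst (_ ∈_) eq (∈-image f x∈)))
    (λ x∈ → ∈-image-injective S (subst (_ ∈_) (sym eq) (∈-image f x∈)))

  -- By injectivity of `f`, the hypothesis says that `x ∈ S` exactly when `f x ∈ S′`, so `S` is the
  -- preimage of `S′`.
  image-∩-trace : ∀ {S S′} → image f S ≡ S′ ∩ image f full →
    ∀ A → image f (A ∩ S) ≡ image f A ∩ S′
  image-∩-trace {S} {S′} eq A = ⊆-antisym to from
    where
    to : image f (A ∩ S) ⊆ image f A ∩ S′
    to y∈ with ∈-image⁻ f (A ∩ S) y∈
    ... | x , x∈ , refl = let x∈A , x∈S = x∈p∩q⁻ A S x∈ in
      x∈p∩q⁺ (∈-image f x∈A , p∩q⊆p S′ _ (subst (_ ∈_) eq (∈-image f x∈S)))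

    from : image f A ∩ S′ ⊆ image f (A ∩ S)
    from y∈ with x∈p∩q⁻ (image f A) S′ y∈
    ... | y∈A , y∈S′ with ∈-image⁻ f A y∈A
    ... | x , x∈A , refl = ∈-image f (x∈p∩q⁺ (x∈A , ∈-image-injective S
      (subst (_ ∈_) (sym eq) (x∈p∩q⁺ (y∈S′ , ∈-image f ∈⊤)))))

image-∘-trace : ∀ {l m n} (f : Fin l → Fin m) (h : Fin m → Fin n) →
  Injective _≡_ _≡_ h → ∀ S T {U} →
  image f S ≡ T ∩ image f full → image h T ≡ U ∩ image h full →
  image (h ∘ f) S ≡ U ∩ image (h ∘ f) full
image-∘-trace f h h-inj S T {U} eq₁ eq₂ = begin
  image (h ∘ f) S               ≡⟨ image-∘ f h S ⟩
  image h (image f S)           ≡⟨ cong (image h) eq₁ ⟩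
  image h (T ∩ image f full)    ≡⟨ cong (image h) (∩-comm T (image f full)) ⟩
  -- The set `image f full` plays the role of `A`: its image under `h` is the whole range of the
  -- composite.
  image h (image f full ∩ T)    ≡⟨ image-∩-trace h-inj eq₂ (image f full) ⟩
  image h (image f full) ∩ U    ≡⟨ ∩-comm _ U ⟩
  U ∩ image h (image f full)    ≡⟨ cong (U ∩_) (image-∘ f h full) ⟨
  U ∩ image (h ∘ f) full        ∎
  where open ≡-Reasoning

-- Composition of SSP reductions

reduction-∘ : ∀ {Π Π′ Π″} → SSPReduction Π Π′ → SSPReduction Π′ Π″ →
  SSPReduction Π Π″
reduction-∘ {Π} {Π′} {Π″} R Q = record
  { g           = Q.g ∘ R.g
  ; g-poly      = polyTime-∘ R.g R.g-poly Q.g-poly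
  ; g-correct   = λ I → ⇔.trans (R.g-correct I) (Q.g-correct (R.g I))
  ; f           = λ I → Q.f (R.g I) ∘ R.f I
  -- The program for `Q.f` expects the code of `R.g I` beside the element, so `R.g` is first run on
  -- the instance component of the input.
  ; f-poly      = polyTime-∘ (λ (I , u) → R.g I , R.f I u)
                    (polyTime-pair
                      (polyTime-∘ proj₁ polyTime-left R.g-poly) R.f-poly)
                    Q.f-poly
  ; f-injective = λ I → R.f-injective I ∘ Q.f-injective (R.g I)
  ; f-solutions = λ I → to I , from I
  }
  where
  module R = SSPReduction R
  module Q = SSPReduction Q

  trace = λ I → image-∘-trace (R.f I) (Q.f (R.g I)) (Q.f-injective (R.g I))

  to : ∀ I {T} →
    ∃[ S ] 𝒮 Π I S × T ≡ image (Q.f (R.g I) ∘ R.f I) S →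
    ∃[ S″ ] 𝒮 Π″ (Q.g (R.g I)) S″ ×
      T ≡ S″ ∩ image (Q.f (R.g I) ∘ R.f I) full
  to I (S , s , refl) =
    let S′ , s′ , eq₁ = proj₁ (R.f-solutions I) (S , s , refl)
        S″ , s″ , eq₂ = proj₁ (Q.f-solutions (R.g I)) (S′ , s′ , refl)
    in S″ , s″ , trace I S S′ eq₁ eq₂

  from : ∀ I {T} →
    ∃[ S″ ] 𝒮 Π″ (Q.g (R.g I)) S″ ×
      T ≡ S″ ∩ image (Q.f (R.g I) ∘ R.f I) full →
    ∃[ S ] 𝒮 Π I S × T ≡ image (Q.f (R.g I) ∘ R.f I) S
  from I (S″ , s″ , refl) =
    let S′ , s′ , eq₂ = proj₂ (Q.f-solutions (R.g I)) (S″ , s″ , refl)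
        S , s , eq₁ = proj₂ (R.f-solutions I) (S′ , s′ , refl)
    in S , s , sym (trace I S S′ (sym eq₁) (sym eq₂))

-- Distance measures

-- The reals are explicit arguments because `_≃ᵣ_` unfolds to a statement about lower cuts alone,
-- which does not determine the rest of the record.
≃ᵣ-trans : ∀ x y z → x ≃ᵣ y → y ≃ᵣ z → x ≃ᵣ z
≃ᵣ-trans _ _ _ (x≤y , y≤x) (y≤z , z≤y) =
  (λ q → y≤z q ∘ x≤y q) , (λ q → y≤x q ∘ z≤y q)

≤ᵣ-congˡ : ∀ x y z → x ≃ᵣ y → x ≤ᵣ z ⇔ y ≤ᵣ z
≤ᵣ-congˡ _ _ _ (x≤y , y≤x) =
  mk⇔ (λ x≤z q → x≤z q ∘ y≤x q) (λ y≤z q → y≤z q ∘ x≤y q)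

x∉p-x : ∀ {n} (p : Subset n) {x} → x ∉ p - x
x∉p-x (_ ∷ p) {zero}  ()
x∉p-x (_ ∷ p) {suc x} (there x∈) = x∉p-x p x∈

∪-remove : ∀ {n} (A : Subset n) {X x} → x ∈ X → (A ∪ (X - x)) ∪ ⁅ x ⁆ ≡ A ∪ X
∪-remove A {X} {x} x∈X = trans (∪-assoc A (X - x) ⁅ x ⁆)
  (cong (A ∪_) (⊆-antisym to from))
  where
  to : (X - x) ∪ ⁅ x ⁆ ⊆ X
  to y∈ with x∈p∪q⁻ (X - x) ⁅ x ⁆ y∈
  ... | inj₁ y∈X-x = p─q⊆p X ⁅ x ⁆ y∈X-x
  ... | inj₂ y∈x rewrite x∈⁅y⁆⇒x≡y x y∈x = x∈X

  from : X ⊆ (X - x) ∪ ⁅ x ⁆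
  from {y} y∈X with y Fin.≟ x
  ... | yes refl = x∈p∪q⁺ (inj₂ (x∈⁅x⁆ x))
  ... | no y≢x   = x∈p∪q⁺ (inj₁ (x∈p∧x≢y⇒x∈p-y y∈X y≢x))

-- Invariance under union adjoins a single element, so `X` is built up one element at a time, by
-- induction along strict inclusion.
dist-∪ : ∀ d U A₁ A₂ X → (∀ {x} → x ∈ X → x ∉ A₁ × x ∉ A₂) →
  dist d U A₁ A₂ ≃ᵣ dist d U (A₁ ∪ X) (A₂ ∪ X)
dist-∪ d U A₁ A₂ X = go X (⊂-wellFounded X)
  where
  go : ∀ X → Acc _⊂_ X → (∀ {x} → x ∈ X → x ∉ A₁ × x ∉ A₂) →
    dist d U A₁ A₂ ≃ᵣ dist d U (A₁ ∪ X) (A₂ ∪ X)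
  go X (acc rec) disj with nonempty? X
  ... | no empty rewrite Empty-unique empty | ∪-identityʳ A₁ | ∪-identityʳ A₂ =
    (λ _ p → p) , (λ _ p → p)
  ... | yes (x , x∈X) = ≃ᵣ-trans
    (dist d U A₁ A₂)
    (dist d U (A₁ ∪ (X - x)) (A₂ ∪ (X - x)))
    (dist d U (A₁ ∪ X) (A₂ ∪ X))
    (go (X - x) (rec (x∈p⇒p-x⊂p x∈X)) (disj ∘ p─q⊆p X ⁅ x ⁆))
    (subst₂ (λ B₁ B₂ → dist d U (A₁ ∪ (X - x)) (A₂ ∪ (X - x)) ≃ᵣ dist d U B₁ B₂)
       (∪-remove A₁ x∈X) (∪-remove A₂ x∈X)
       (dist-union d U (A₁ ∪ (X - x)) (A₂ ∪ (X - x)) x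
         -- The new element is still fresh: it avoids `A₁` and `A₂` by disjointness, and it was
         -- removed from `X`.
         ([ x∉ (proj₁ (disj x∈X)) , x∉ (proj₂ (disj x∈X)) ]′
           ∘ x∈p∪q⁻ (A₁ ∪ (X - x)) (A₂ ∪ (X - x)))))
    where
    x∉ : ∀ {A} → x ∉ A → x ∉ A ∪ (X - x)
    x∉ {A} x∉A x∈ with x∈p∪q⁻ A (X - x) x∈
    ... | inj₁ x∈A   = x∉A x∈A
    ... | inj₂ x∈X-x = x∉p-x X x∈X-x

∩-∪-∩∁ : ∀ {n} (S M : Subset n) → (S ∩ M) ∪ (S ∩ ∁ M) ≡ S
∩-∪-∩∁ S M = begin
  (S ∩ M) ∪ (S ∩ ∁ M)  ≡⟨ ∩-distribˡ-∪ S M (∁ M) ⟨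
  S ∩ (M ∪ ∁ M)        ≡⟨ cong (S ∩_) (p∪∁p≡⊤ M) ⟩
  S ∩ full             ≡⟨ ∩-identityʳ S ⟩
  S                    ∎
  where open ≡-Reasoning

-- The common part outside `M` is disjoint from both intersections with `M`; adjoining it by
-- `dist-∪` restores `S₁` and `S₂`.
dist-∩ : ∀ d U S₁ S₂ M → S₁ ∩ ∁ M ≡ S₂ ∩ ∁ M →
  dist d U (S₁ ∩ M) (S₂ ∩ M) ≃ᵣ dist d U S₁ S₂
dist-∩ d U S₁ S₂ M eq =
  subst₂ (λ B₁ B₂ → dist d U (S₁ ∩ M) (S₂ ∩ M) ≃ᵣ dist d U B₁ B₂)
    (∩-∪-∩∁ S₁ M)
    (trans (cong ((S₂ ∩ M) ∪_) eq) (∩-∪-∩∁ S₂ M))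
    (dist-∪ d U (S₁ ∩ M) (S₂ ∩ M) (S₁ ∩ ∁ M) λ x∈ →
      let x∉M = x∈∁p⇒x∉p (p∩q⊆q S₁ (∁ M) x∈)
      in x∉M ∘ p∩q⊆q S₁ M , x∉M ∘ p∩q⊆q S₂ M)

-- Distances between solutions under a blow-up preserving reduction

module _ {Π Π′} (B : BlowUpPreservingReduction Π Π′) where
  open BlowUpPreservingReduction B

  -- An element outside the image lies in no solution or in all of them, so its membership does not
  -- depend on the solution.
  solutions-agree-∁ : ∀ I {S₁ S₂} → 𝒮 Π′ (g I) S₁ → 𝒮 Π′ (g I) S₂ →
    S₁ ∩ ∁ (image (f I) full) ≡ S₂ ∩ ∁ (image (f I) full)
  solutions-agree-∁ I s₁ s₂ = ⊆-antisym (incl s₁ s₂) (incl s₂ s₁)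
    where
    incl : ∀ {S₁ S₂} → 𝒮 Π′ (g I) S₁ → 𝒮 Π′ (g I) S₂ →
      S₁ ∩ ∁ (image (f I) full) ⊆ S₂ ∩ ∁ (image (f I) full)
    incl {S₁} {S₂} s₁ s₂ {x} x∈ with x∈p∩q⁻ S₁ _ x∈
    ... | x∈S₁ , x∈∁ with preserving I x
    ... | inj₁ x∈M          = ⊥-elim (x∈∁p⇒x∉p x∈∁ x∈M)
    ... | inj₂ (inj₁ never)  = ⊥-elim (never S₁ s₁ x∈S₁)
    ... | inj₂ (inj₂ always) = x∈p∩q⁺ (always S₂ s₂ , x∈∁)

  -- Invariance under injections passes from `T₁`, `T₂` to the parts of `S₁`, `S₂` inside the image;
  -- `dist-∩` then restores the parts outside.
  dist-trace : ∀ d I {T₁ T₂ S₁ S₂} → 𝒮 Π′ (g I) S₁ → 𝒮 Π′ (g I) S₂ →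
    image (f I) T₁ ≡ S₁ ∩ image (f I) full →
    image (f I) T₂ ≡ S₂ ∩ image (f I) full →
    dist d (𝒰 Π I) T₁ T₂ ≃ᵣ dist d (𝒰 Π′ (g I)) S₁ S₂
  dist-trace d I {T₁} {T₂} {S₁} {S₂} s₁ s₂ eq₁ eq₂ = ≃ᵣ-trans
    (dist d (𝒰 Π I) T₁ T₂)
    (dist d (𝒰 Π′ (g I)) (S₁ ∩ image (f I) full) (S₂ ∩ image (f I) full))
    (dist d (𝒰 Π′ (g I)) S₁ S₂)
    (subst₂ (λ B₁ B₂ → dist d (𝒰 Π I) T₁ T₂ ≃ᵣ dist d (𝒰 Π′ (g I)) B₁ B₂)
      eq₁ eq₂ (dist-injective d _ _ (f I) (f-injective I) T₁ T₂))
    (dist-∩ d _ S₁ S₂ (image (f I) full) (solutions-agree-∁ I s₁ s₂))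

-- Transfer of blow-up reducibility

theorem4 : (d : DistanceMeasure) (Π : SSP) →
    SSP-NP-complete Π →
    BlowUpReducible d Π →
    (Π′ : SSP) →
    BlowUpPreservingReduction Π Π′ →
    BlowUpReducible d Π′
theorem4 d Π _ reducible Π′ B I L-b closed
  with reducible I L-b closed
... | R , β , β-poly , blowUp =
  -- `β` depends only on the `3Sat` instance, which is also the source of the composite, so `β-poly`
  -- carries over.
  reduction-∘ R Q.reduction , β , β-poly , blowUp′
  where
  module R = SSPReduction R
  module Q = BlowUpPreservingReduction B

  J = R.g I
  h = Q.f J

  blowUp′ : ∀ S₁ S₂ → 𝒮 Π′ (Q.g J) S₁ → 𝒮 Π′ (Q.g J) S₂ →
    (image (h ∘ R.f I) L-b ∩ S₁ ≡ image (h ∘ R.f I) L-b ∩ S₂) ⇔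
    (dist d (𝒰 Π′ (Q.g J)) S₁ S₂ ≤ᵣ fromℕᵣ (β I))
  blowUp′ S₁ S₂ s₁ s₂
    -- The trace of each solution on the range of `h` is the image of a solution of `J`, to which
    -- `blowUp` applies.
    with proj₂ (Q.f-solutions J) (S₁ , s₁ , refl)
       | proj₂ (Q.f-solutions J) (S₂ , s₂ , refl)
  ... | T₁ , t₁ , eq₁ | T₂ , t₂ , eq₂ =
    ⇔.trans traces
      (⇔.trans (blowUp T₁ T₂ t₁ t₂)
        (≤ᵣ-congˡ
          (dist d (𝒰 Π J) T₁ T₂) (dist d (𝒰 Π′ (Q.g J)) S₁ S₂) (fromℕᵣ (β I))
          (dist-trace B d J s₁ s₂ (sym eq₁) (sym eq₂))))
    where
    -- This identifies agreement on the copy of `L-b` in `Π′` with the `h`-image of agreement on its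
    -- copy in `Π`.
    trace : ∀ {S T} → S ∩ image h full ≡ image h T →
      image h (image (R.f I) L-b ∩ T) ≡ image (h ∘ R.f I) L-b ∩ S
    trace {S} eq = trans
      (image-∩-trace (Q.f-injective J) (sym eq) (image (R.f I) L-b))
      (cong (_∩ S) (sym (image-∘ (R.f I) h L-b)))

    traces :
      (image (h ∘ R.f I) L-b ∩ S₁ ≡ image (h ∘ R.f I) L-b ∩ S₂) ⇔
      (image (R.f I) L-b ∩ T₁ ≡ image (R.f I) L-b ∩ T₂)
    traces = mk⇔
      -- Only this direction has to cancel `image h`, hence the appeal to injectivity.
      (λ eq → image-injective (Q.f-injective J)
        (trans (trace eq₁) (trans eq (sym (trace eq₂)))))
      (λ eq → trans (sym (trace eq₁)) (trans (cong (image h) eq) (trace eq₂)))
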